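{- Let $\mathcal L$ be a summable category with summability structure $(\mathbf S,\pi_0,\pi_1,\sigma)$. Then the triple $(\mathbf S,\iota_0,\theta)$ is a monad on $\mathcal L$, where $\iota_0=\langle\!\langle \mathrm{Id}_X,0\rangle\!\rangle\in\mathcal L(X,\mathbf SX)$ is the unit and $\theta_X=\langle\!\langle \pi_0\pi_0,\ \pi_0\pi_1+\pi_1\pi_0\rangle\!\rangle\in\mathcal L(\mathbf S^2X,\mathbf SX)$ is the multiplication.
   Context: A category $\mathcal L$ has zero-morphisms if each hom-set $\mathcal L(X,Y)$ has a distinguished element $0=0_{X,Y}$ with $f\,0=0$ and $0\,f=0$ for all composable $f$. A pre-summability structure on such an $\mathcal L$ is a tuple $(\mathbf S,\pi_0,\pi_1,\sigma)$ where $\mathbf S:\mathcal L\to\mathcal L$ is a functor and $\pi_0,\pi_1,\sigma$ are natural transformations with components in $\mathcal L(\mathbf SX,X)$ such that $\pi_0,\pi_1$ are jointly monic (if $\pi_i f=\pi_i g$ for $i=0,1$ then $f=g$). Morphisms $f_0,f_1\in\mathcal L(Y,X)$ are summable if there is $h\in\mathcal L(Y,\mathbf SX)$ with $\pi_ih=f_i$ for $i=0,1$; this $h$ is unique, it is written $\langle\!\langle f_0,f_1\rangle\!\rangle$ (the witness), and $f_0+f_1:=\sigma\,\langle\!\langle f_0,f_1\rangle\!\rangle$. A summability structure is a pre-summability structure such that: ($\mathbf S$-com) $\pi_1$ and $\pi_0$ are summable (in this order) with $\pi_1+\pi_0=\sigma$; ($\mathbf S$-zero) $0_{X,X}$ and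 $\mathrm{Id}_X$ are summable with $0+\mathrm{Id}_X=\mathrm{Id}_X$; ($\mathbf S$-wit) for any $f_0,f_1\in\mathcal L(X,\mathbf SY)$, if $\sigma f_0$ and $\sigma f_1$ are summable then $f_0$ and $f_1$ are summable. A summable category is a category with zero-morphisms equipped with a summability structure. In a summable category the witnesses defining $\iota_0$ and $\theta$ exist: $\mathrm{Id}_X$ and $0$ are summable, $\pi_0\pi_1$ and $\pi_1\pi_0$ (morphisms $\mathbf S^2X\to X$) are summable, and $\pi_0\pi_0$ and $\pi_0\pi_1+\pi_1\pi_0$ are summable. -}

module Defs where

open import Level using (Level; suc; _⊔_)
open import Data.Product using (Σ-syntax; proj₁; proj₂)
open import Relation.Binary.Bundles using (Setoid)
open import Relation.Binary.Structures using (IsEquivalence)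
import Relation.Binary.Reasoning.Setoid as SetoidReasoning

-- Equality of morphisms is an arbitrary equivalence relation on each
-- hom-set, since quotients of hom-types are not available.
record Category (o ℓ e : Level) : Set (suc (o ⊔ ℓ ⊔ e)) where
  infix  4 _≈_ _⇒_
  infixr 9 _∘_
  field
    Obj   : Set o
    _⇒_   : Obj → Obj → Set ℓ
    _≈_   : ∀ {A B} → A ⇒ B → A ⇒ B → Set e
    id    : ∀ {A} → A ⇒ A
    _∘_   : ∀ {A B C} → B ⇒ C → A ⇒ B → A ⇒ C
    equiv : ∀ {A B} → IsEquivalence (_≈_ {A} {B})
    ∘-resp-≈  : ∀ {A B C} {f h : B ⇒ C} {g i : A ⇒ B} →
                f ≈ h → g ≈ i → f ∘ g ≈ h ∘ i
    assoc     : ∀ {A B C D} {f : A ⇒ B} {g : B ⇒ C} {h : C ⇒ D} →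
                (h ∘ g) ∘ f ≈ h ∘ (g ∘ f)
    identityˡ : ∀ {A B} {f : A ⇒ B} → id ∘ f ≈ f
    identityʳ : ∀ {A B} {f : A ⇒ B} → f ∘ id ≈ f

  module Equiv {A B : Obj} = IsEquivalence (equiv {A} {B})

  hom-setoid : (A B : Obj) → Setoid ℓ e
  hom-setoid A B = record { Carrier = A ⇒ B ; _≈_ = _≈_ ; isEquivalence = equiv }

  module HomReasoning {A B : Obj} = SetoidReasoning (hom-setoid A B)

  ∘-resp-≈ˡ : ∀ {A B C} {f h : B ⇒ C} {g : A ⇒ B} → f ≈ h → f ∘ g ≈ h ∘ g
  ∘-resp-≈ˡ p = ∘-resp-≈ p Equiv.refl

  ∘-resp-≈ʳ : ∀ {A B C} {f : B ⇒ C} {g i : A ⇒ B} → g ≈ i → f ∘ g ≈ f ∘ i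
  ∘-resp-≈ʳ p = ∘-resp-≈ Equiv.refl p

record Functor {o ℓ e o′ ℓ′ e′ : Level}
               (C : Category o ℓ e) (D : Category o′ ℓ′ e′) :
               Set (o ⊔ ℓ ⊔ e ⊔ o′ ⊔ ℓ′ ⊔ e′) where
  private
    module C = Category C
    module D = Category D
  field
    F₀ : C.Obj → D.Obj
    F₁ : ∀ {A B} → A C.⇒ B → F₀ A D.⇒ F₀ B
    F-resp-≈     : ∀ {A B} {f g : A C.⇒ B} → f C.≈ g → F₁ f D.≈ F₁ g
    identity     : ∀ {A} → F₁ (C.id {A}) D.≈ D.id
    homomorphism : ∀ {X Y Z} {f : X C.⇒ Y} {g : Y C.⇒ Z} →
                   F₁ (g C.∘ f) D.≈ F₁ g D.∘ F₁ f

idF : ∀ {o ℓ e} {C : Category o ℓ e} → Functor C C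
idF {C = C} = record
  { F₀ = λ X → X
  ; F₁ = λ f → f
  ; F-resp-≈ = λ p → p
  ; identity = Category.Equiv.refl C
  ; homomorphism = Category.Equiv.refl C
  }

infixr 9 _∘F_
_∘F_ : ∀ {o ℓ e o′ ℓ′ e′ o″ ℓ″ e″}
       {C : Category o ℓ e} {D : Category o′ ℓ′ e′} {E : Category o″ ℓ″ e″} →
       Functor D E → Functor C D → Functor C E
_∘F_ {E = E} G F = record
  { F₀ = λ X → G.F₀ (F.F₀ X)
  ; F₁ = λ f → G.F₁ (F.F₁ f)
  ; F-resp-≈ = λ p → G.F-resp-≈ (F.F-resp-≈ p)
  ; identity = E.Equiv.trans (G.F-resp-≈ F.identity) G.identity
  ; homomorphism = E.Equiv.trans (G.F-resp-≈ F.homomorphism) G.homomorphism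
  }
  where
    module F = Functor F
    module G = Functor G
    module E = Category E

module _ {o ℓ e o′ ℓ′ e′ : Level}
         {C : Category o ℓ e} {D : Category o′ ℓ′ e′} where
  private
    module C = Category C
    module D = Category D

  IsNatural : (F G : Functor C D) →
              (∀ X → Functor.F₀ F X D.⇒ Functor.F₀ G X) → Set (o ⊔ ℓ ⊔ e′)
  IsNatural F G α = ∀ {X Y} (f : X C.⇒ Y) → α Y D.∘ F.F₁ f D.≈ G.F₁ f D.∘ α X
    where
      module F = Functor F
      module G = Functor G

record IsMonad {o ℓ e : Level} {C : Category o ℓ e} (T : Functor C C)
               (η : ∀ X → Category._⇒_ C X (Functor.F₀ T X))
               (μ : ∀ X → Category._⇒_ C (Functor.F₀ T (Functor.F₀ T X)) (Functor.F₀ T X)) :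
               Set (o ⊔ ℓ ⊔ e) where
  open Category C using (_≈_; _∘_; id)
  open Functor T using (F₀; F₁)
  field
    η-natural   : IsNatural idF T η
    μ-natural   : IsNatural (T ∘F T) T μ
    μ-assoc     : ∀ X → μ X ∘ F₁ (μ X) ≈ μ X ∘ μ (F₀ X)
    μ-identityˡ : ∀ X → μ X ∘ F₁ (η X) ≈ id
    μ-identityʳ : ∀ X → μ X ∘ η (F₀ X) ≈ id

record ZeroMorphisms {o ℓ e : Level} (L : Category o ℓ e) : Set (o ⊔ ℓ ⊔ e) where
  open Category L
  field
    0⇒      : ∀ {X Y} → X ⇒ Y
    ∘-zeroʳ : ∀ {X Y Z} (f : Y ⇒ Z) → f ∘ 0⇒ {X} {Y} ≈ 0⇒
    ∘-zeroˡ : ∀ {X Y Z} (f : X ⇒ Y) → 0⇒ {Y} {Z} ∘ f ≈ 0⇒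

record PreSummability {o ℓ e : Level} (L : Category o ℓ e) : Set (o ⊔ ℓ ⊔ e) where
  open Category L
  field
    S : Functor L L
  open Functor S public using () renaming (F₀ to S₀; F₁ to S₁)
  field
    π₀ π₁ σ    : ∀ X → S₀ X ⇒ X
    π₀-natural : IsNatural S idF π₀
    π₁-natural : IsNatural S idF π₁
    σ-natural  : IsNatural S idF σ
    π-jointly-monic : ∀ {X Y} {f g : Y ⇒ S₀ X} →
                      π₀ X ∘ f ≈ π₀ X ∘ g → π₁ X ∘ f ≈ π₁ X ∘ g → f ≈ g

  record Summable {X Y : Obj} (f₀ f₁ : Y ⇒ X) : Set (ℓ ⊔ e) where
    constructor summable
    field
      witness    : Y ⇒ S₀ X
      π₀-witness : π₀ X ∘ witness ≈ f₀
      π₁-witness : π₁ X ∘ witness ≈ f₁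

  open Summable public

  -- f₀ + f₁ is only partially defined, so it takes the summability of f₀ and
  -- f₁ as its argument; by joint monicity it does not depend on it up to ≈.
  sum : ∀ {X Y} {f₀ f₁ : Y ⇒ X} → Summable f₀ f₁ → Y ⇒ X
  sum {X} s = σ X ∘ witness s

record Summability {o ℓ e : Level} (L : Category o ℓ e) (Z : ZeroMorphisms L) :
                   Set (o ⊔ ℓ ⊔ e) where
  open Category L
  open ZeroMorphisms Z
  field
    preSummability : PreSummability L
  open PreSummability preSummability public
  field
    S-com  : ∀ X → Σ[ s ∈ Summable (π₁ X) (π₀ X) ] sum s ≈ σ X
    S-zero : ∀ X → Σ[ s ∈ Summable (0⇒ {X} {X}) (id {X}) ] sum s ≈ id {X}
    S-wit  : ∀ {X Y} (f₀ f₁ : X ⇒ S₀ Y) →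
             Summable (σ Y ∘ f₀) (σ Y ∘ f₁) → Summable f₀ f₁

record SummableCategory (o ℓ e : Level) : Set (suc (o ⊔ ℓ ⊔ e)) where
  field
    L             : Category o ℓ e
    zeroMorphisms : ZeroMorphisms L
    summability   : Summability L zeroMorphisms

  open Category L public
  open ZeroMorphisms zeroMorphisms public
  open Summability summability public

  private
    pullˡ : ∀ {A B C D} {f : A ⇒ B} {g : B ⇒ C} {h : C ⇒ D} {k : B ⇒ D} →
            h ∘ g ≈ k → h ∘ (g ∘ f) ≈ k ∘ f
    pullˡ p = Equiv.trans (Equiv.sym assoc) (∘-resp-≈ˡ p)

  γ : ∀ X → S₀ X ⇒ S₀ X
  γ X = witness (proj₁ (S-com X))

  ι₁ : ∀ X → X ⇒ S₀ X
  ι₁ X = witness (proj₁ (S-zero X))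

  π₀∘γ : ∀ {X} → π₀ X ∘ γ X ≈ π₁ X
  π₀∘γ {X} = π₀-witness (proj₁ (S-com X))

  π₁∘γ : ∀ {X} → π₁ X ∘ γ X ≈ π₀ X
  π₁∘γ {X} = π₁-witness (proj₁ (S-com X))

  σ∘γ : ∀ {X} → σ X ∘ γ X ≈ σ X
  σ∘γ {X} = proj₂ (S-com X)

  π₀∘ι₁ : ∀ {X} → π₀ X ∘ ι₁ X ≈ 0⇒
  π₀∘ι₁ {X} = π₀-witness (proj₁ (S-zero X))

  π₁∘ι₁ : ∀ {X} → π₁ X ∘ ι₁ X ≈ id
  π₁∘ι₁ {X} = π₁-witness (proj₁ (S-zero X))

  σ∘ι₁ : ∀ {X} → σ X ∘ ι₁ X ≈ id
  σ∘ι₁ {X} = proj₂ (S-zero X)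

  summable-resp-≈ : ∀ {X Y} {f₀ f₁ g₀ g₁ : Y ⇒ X} →
                    f₀ ≈ g₀ → f₁ ≈ g₁ → Summable f₀ f₁ → Summable g₀ g₁
  summable-resp-≈ p q s = summable (witness s)
    (Equiv.trans (π₀-witness s) p) (Equiv.trans (π₁-witness s) q)

  summable-sym : ∀ {X Y} {f₀ f₁ : Y ⇒ X} → Summable f₀ f₁ → Summable f₁ f₀
  summable-sym {X} s = summable (γ X ∘ witness s)
    (Equiv.trans (pullˡ π₀∘γ) (π₁-witness s))
    (Equiv.trans (pullˡ π₁∘γ) (π₀-witness s))

  summable-∘ˡ : ∀ {X X′ Y} (g : X ⇒ X′) {f₀ f₁ : Y ⇒ X} →
                Summable f₀ f₁ → Summable (g ∘ f₀) (g ∘ f₁)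
  summable-∘ˡ g s = summable (S₁ g ∘ witness s)
    (Equiv.trans (pullˡ (π₀-natural g)) (Equiv.trans assoc (∘-resp-≈ʳ (π₀-witness s))))
    (Equiv.trans (pullˡ (π₁-natural g)) (Equiv.trans assoc (∘-resp-≈ʳ (π₁-witness s))))

  sum-cong : ∀ {X Y} {f₀ f₁ g₀ g₁ : Y ⇒ X} → f₀ ≈ g₀ → f₁ ≈ g₁ →
             (s : Summable f₀ f₁) (t : Summable g₀ g₁) → sum s ≈ sum t
  sum-cong p q s t = ∘-resp-≈ʳ (π-jointly-monic
    (Equiv.trans (π₀-witness s) (Equiv.trans p (Equiv.sym (π₀-witness t))))
    (Equiv.trans (π₁-witness s) (Equiv.trans q (Equiv.sym (π₁-witness t)))))

  id-0-summable : ∀ X → Summable (id {X}) (0⇒ {X} {X})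
  id-0-summable X = summable-sym (proj₁ (S-zero X))

  private
    σπ-summable : ∀ X → Summable (σ X ∘ π₀ (S₀ X)) (σ X ∘ π₁ (S₀ X))
    σπ-summable X = summable (S₁ (σ X)) (π₀-natural (σ X)) (π₁-natural (σ X))

  π₀π₁-π₁π₀-summable : ∀ X → Summable (π₀ X ∘ π₁ (S₀ X)) (π₁ X ∘ π₀ (S₀ X))
  π₀π₁-π₁π₀-summable X = summable-sym
    (summable-resp-≈ (pullˡ π₀∘γ) Equiv.refl
      (summable-∘ˡ (π₀ X)
        (S-wit (γ X ∘ π₀ (S₀ X)) (π₁ (S₀ X))
          (summable-resp-≈ (Equiv.sym (pullˡ σ∘γ)) Equiv.refl (σπ-summable X)))))

  private
    -- In S²X write a, b for the components of π₀ and c, d for those of π₁.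
    -- From a + b and c + d summable, so are a + b and c.
    σπ₀-π₀π₁-summable : ∀ X → Summable (σ X ∘ π₀ (S₀ X)) (π₀ X ∘ π₁ (S₀ X))
    σπ₀-π₀π₁-summable X =
      summable-resp-≈ (Equiv.trans (pullˡ π₁∘ι₁) identityˡ) (pullˡ π₁∘γ)
        (summable-∘ˡ (π₁ X)
          (S-wit (ι₁ X ∘ (σ X ∘ π₀ (S₀ X))) (γ X ∘ π₁ (S₀ X))
            (summable-resp-≈
              (Equiv.sym (Equiv.trans (pullˡ σ∘ι₁) identityˡ))
              (Equiv.sym (pullˡ σ∘γ))
              (σπ-summable X))))

    -- The pairs (0 , c) and (a , b) are therefore summable; summing
    -- componentwise gives 0 + a and c + b.
    rows : ∀ X → Summable (ι₁ X ∘ (π₀ X ∘ π₁ (S₀ X))) (π₀ (S₀ X))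
    rows X = S-wit _ _
      (summable-resp-≈ (Equiv.sym (Equiv.trans (pullˡ σ∘ι₁) identityˡ)) Equiv.refl
        (summable-sym (σπ₀-π₀π₁-summable X)))

  π₀π₀-[π₀π₁+π₁π₀]-summable :
    ∀ X → Summable (π₀ X ∘ π₀ (S₀ X)) (sum (π₀π₁-π₁π₀-summable X))
  π₀π₀-[π₀π₁+π₁π₀]-summable X = summable (σ (S₀ X) ∘ witness (rows X)) left right
    where
      column₀ : Summable (π₀ X ∘ (ι₁ X ∘ (π₀ X ∘ π₁ (S₀ X)))) (π₀ X ∘ π₀ (S₀ X))
      column₀ = summable-∘ˡ (π₀ X) (rows X)

      column₁ : Summable (π₁ X ∘ (ι₁ X ∘ (π₀ X ∘ π₁ (S₀ X)))) (π₁ X ∘ π₀ (S₀ X))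
      column₁ = summable-∘ˡ (π₁ X) (rows X)

      ι₁a : Summable 0⇒ (π₀ X ∘ π₀ (S₀ X))
      ι₁a = summable (ι₁ X ∘ (π₀ X ∘ π₀ (S₀ X)))
        (Equiv.trans (pullˡ π₀∘ι₁) (∘-zeroˡ _))
        (Equiv.trans (pullˡ π₁∘ι₁) identityˡ)

      left : π₀ X ∘ (σ (S₀ X) ∘ witness (rows X)) ≈ π₀ X ∘ π₀ (S₀ X)
      left = begin
        π₀ X ∘ (σ (S₀ X) ∘ witness (rows X))     ≈⟨ pullˡ (Equiv.sym (σ-natural (π₀ X))) ⟩
        (σ X ∘ S₁ (π₀ X)) ∘ witness (rows X)     ≈⟨ assoc ⟩
        sum column₀                              ≈⟨ sum-cong
                                                      (Equiv.trans (pullˡ π₀∘ι₁) (∘-zeroˡ _))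
                                                      Equiv.refl column₀ ι₁a ⟩
        σ X ∘ (ι₁ X ∘ (π₀ X ∘ π₀ (S₀ X)))        ≈⟨ pullˡ σ∘ι₁ ⟩
        id ∘ (π₀ X ∘ π₀ (S₀ X))                  ≈⟨ identityˡ ⟩
        π₀ X ∘ π₀ (S₀ X)                         ∎
        where open HomReasoning

      right : π₁ X ∘ (σ (S₀ X) ∘ witness (rows X)) ≈ sum (π₀π₁-π₁π₀-summable X)
      right = begin
        π₁ X ∘ (σ (S₀ X) ∘ witness (rows X))     ≈⟨ pullˡ (Equiv.sym (σ-natural (π₁ X))) ⟩
        (σ X ∘ S₁ (π₁ X)) ∘ witness (rows X)     ≈⟨ assoc ⟩
        sum column₁                              ≈⟨ sum-cong
                                                      (Equiv.trans (pullˡ π₁∘ι₁) identityˡ)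
                                                      Equiv.refl column₁ (π₀π₁-π₁π₀-summable X) ⟩
        sum (π₀π₁-π₁π₀-summable X)               ∎
        where open HomReasoning

  ι₀ : ∀ X → X ⇒ S₀ X
  ι₀ X = witness (id-0-summable X)

  θ : ∀ X → S₀ (S₀ X) ⇒ S₀ X
  θ X = witness (π₀π₀-[π₀π₁+π₁π₀]-summable X)

{-# OPTIONS --safe #-}
-- The projections are jointly monic, so each monad law may be checked after
-- π₀ and after π₁. After π₁, associativity of θ becomes
--   π₀π₀π₁ + (π₀π₁π₀ + π₁π₀π₀) = (π₀π₀π₁ + π₀π₁π₀) + π₁π₀π₀,
-- an instance of associativity of the partial sum. For the latter, S-wit makes
-- the pairs (x , 0) and (y , z) summable; naturality of σ at σ then says that
-- summing the 2 × 2 array by rows or by columns gives the same result.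
module Submission where

open import Level using (Level)
open import Data.Product using (proj₁)
open import Defs

module SumProperties {o ℓ e : Level} (𝓛 : SummableCategory o ℓ e) where
  open SummableCategory 𝓛
  open HomReasoning
  open Equiv using (refl; sym; trans)

  pullˡ : ∀ {A B C D} {f : A ⇒ B} {g : B ⇒ C} {h : C ⇒ D} {k : B ⇒ D} →
          h ∘ g ≈ k → h ∘ (g ∘ f) ≈ k ∘ f
  pullˡ p = trans (sym assoc) (∘-resp-≈ˡ p)

  extendʳ : ∀ {A B B′ C D} {f : A ⇒ B} {g : B ⇒ C} {h : C ⇒ D}
            {g′ : B ⇒ B′} {h′ : B′ ⇒ D} →
            h ∘ g ≈ h′ ∘ g′ → h ∘ (g ∘ f) ≈ h′ ∘ (g′ ∘ f)
  extendʳ p = trans (pullˡ p) assoc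

  cancelˡ : ∀ {A B C} {f : A ⇒ B} {g : B ⇒ C} {h : C ⇒ B} →
            h ∘ g ≈ id → h ∘ (g ∘ f) ≈ f
  cancelˡ p = trans (pullˡ p) identityˡ

  annihilateˡ : ∀ {A B C D} {f : A ⇒ B} {g : B ⇒ C} {h : C ⇒ D} →
                h ∘ g ≈ 0⇒ → h ∘ (g ∘ f) ≈ 0⇒
  annihilateˡ p = trans (pullˡ p) (∘-zeroˡ _)

  summable-∘ʳ : ∀ {X Y Z} {f₀ f₁ : Y ⇒ X} → Summable f₀ f₁ → (g : Z ⇒ Y) →
                Summable (f₀ ∘ g) (f₁ ∘ g)
  summable-∘ʳ s g = summable (witness s ∘ g)
    (pullˡ (π₀-witness s)) (pullˡ (π₁-witness s))

  -- The witness of `summable-∘ˡ g s` is `S₁ g ∘ witness s` by definition, so this is naturality of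
  -- `σ` at `g`.
  ∘-distribˡ-sum : ∀ {X X′ Y} (g : X ⇒ X′) {f₀ f₁ : Y ⇒ X}
                   (s : Summable f₀ f₁) → g ∘ sum s ≈ sum (summable-∘ˡ g s)
  ∘-distribˡ-sum g s = extendʳ (sym (σ-natural g))

  π₀∘ι₀ : ∀ {X} → π₀ X ∘ ι₀ X ≈ id
  π₀∘ι₀ {X} = π₀-witness (id-0-summable X)

  π₁∘ι₀ : ∀ {X} → π₁ X ∘ ι₀ X ≈ 0⇒
  π₁∘ι₀ {X} = π₁-witness (id-0-summable X)

  σ∘ι₀ : ∀ {X} → σ X ∘ ι₀ X ≈ id
  -- By construction `ι₀ X` is `γ X ∘ ι₁ X`, and `σ` absorbs the swap `γ`.
  σ∘ι₀ = trans (pullˡ σ∘γ) σ∘ι₁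

  summable-zeroʳ : ∀ {X Y} (f : Y ⇒ X) → Summable f 0⇒
  summable-zeroʳ {X} f = summable-resp-≈ identityˡ (∘-zeroˡ f)
    (summable-∘ʳ (id-0-summable X) f)

  summable-zeroˡ : ∀ {X Y} (f : Y ⇒ X) → Summable 0⇒ f
  summable-zeroˡ {X} f = summable-resp-≈ (∘-zeroˡ f) identityˡ
    (summable-∘ʳ (proj₁ (S-zero X)) f)

  -- A sum does not depend on its witness, so `s` may be traded for the summability witnessed by
  -- `ι₀ X ∘ f`, where `σ` cancels `ι₀`.
  sum-identityʳ : ∀ {X Y} {f : Y ⇒ X} (s : Summable f 0⇒) → sum s ≈ f
  sum-identityʳ {f = f} s =
    trans (sum-cong refl refl s (summable-zeroʳ f)) (cancelˡ σ∘ι₀)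

  sum-identityˡ : ∀ {X Y} {f : Y ⇒ X} (s : Summable 0⇒ f) → sum s ≈ f
  sum-identityˡ {f = f} s =
    trans (sum-cong refl refl s (summable-zeroˡ f)) (cancelˡ σ∘ι₁)

  sum-assoc : ∀ {X Y} {x y z : Y ⇒ X}
              (xy : Summable x y) (xy,z : Summable (sum xy) z)
              (yz : Summable y z) (x,yz : Summable x (sum yz)) →
              sum xy,z ≈ sum x,yz
  sum-assoc {X} {Y} {x} {y} {z} xy xy,z yz x,yz = begin
    sum xy,z                       ≈⟨ sum-cong (sym column₀-sum) (sym column₁-sum)
                                               xy,z columns ⟩
    σ X ∘ (σ (S₀ X) ∘ witness m)   ≈⟨ extendʳ (σ-natural (σ X)) ⟨
    σ X ∘ (S₁ (σ X) ∘ witness m)   ≈⟨ sum-cong (cancelˡ σ∘ι₀) refl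
                                               (summable-∘ˡ (σ X) m) x,yz ⟩
    sum x,yz                       ∎
    where
      -- The rows of the array: `ι₀ X ∘ x` is the pair (x, 0), with sum x, so `x,yz` is the
      -- summability of row sums that `S-wit` asks for.
      m : Summable (ι₀ X ∘ x) (witness yz)
      m = S-wit _ _ (summable-resp-≈ (sym (cancelˡ σ∘ι₀)) refl x,yz)

      -- `sum m` adds the rows componentwise. As a morphism into `S₀ X` it witnesses that its own
      -- two components, the column sums x + y and 0 + z, are summable.
      columns : Summable (π₀ X ∘ sum m) (π₁ X ∘ sum m)
      columns = summable (sum m) refl refl

      column₀-sum : π₀ X ∘ sum m ≈ sum xy
      column₀-sum = trans (∘-distribˡ-sum (π₀ X) m)
        (sum-cong (cancelˡ π₀∘ι₀) (π₀-witness yz) (summable-∘ˡ (π₀ X) m) xy)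

      column₁-sum : π₁ X ∘ sum m ≈ z
      column₁-sum = trans (∘-distribˡ-sum (π₁ X) m)
        (trans (sum-cong (annihilateˡ π₁∘ι₀) (π₁-witness yz)
                         (summable-∘ˡ (π₁ X) m) (summable-zeroˡ z))
               (sum-identityˡ (summable-zeroˡ z)))

  π₀∘θ : ∀ {X} → π₀ X ∘ θ X ≈ π₀ X ∘ π₀ (S₀ X)
  π₀∘θ {X} = π₀-witness (π₀π₀-[π₀π₁+π₁π₀]-summable X)

  π₀∘θ∘ : ∀ {X Y} {g : Y ⇒ S₀ (S₀ X)} →
          π₀ X ∘ (θ X ∘ g) ≈ π₀ X ∘ (π₀ (S₀ X) ∘ g)
  π₀∘θ∘ = extendʳ π₀∘θ

  -- These are the summands of the second component of `θ X ∘ g`. They are bracketed to the right so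
  -- that naturality of the inner projection applies directly when `g` is some `S₁ f`.
  θ-summable : ∀ {X Y} (g : Y ⇒ S₀ (S₀ X)) →
               Summable (π₀ X ∘ (π₁ (S₀ X) ∘ g)) (π₁ X ∘ (π₀ (S₀ X) ∘ g))
  θ-summable {X} g = summable-resp-≈ assoc assoc
    (summable-∘ʳ (π₀π₁-π₁π₀-summable X) g)

  -- Replacing the summands by equal ones keeps the witness, so the right-hand side unfolds to `σ X`
  -- after the original witness after `g`.
  π₁∘θ∘ : ∀ {X Y} (g : Y ⇒ S₀ (S₀ X)) →
          π₁ X ∘ (θ X ∘ g) ≈ sum (θ-summable g)
  π₁∘θ∘ {X} g =
    extendʳ (π₁-witness (π₀π₀-[π₀π₁+π₁π₀]-summable X))

  ι₀-natural : IsNatural idF S ι₀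
  ι₀-natural f = π-jointly-monic
    (trans (cancelˡ π₀∘ι₀)
      (sym (trans (extendʳ (π₀-natural f))
        (trans (∘-resp-≈ʳ π₀∘ι₀) identityʳ))))
    (trans (annihilateˡ π₁∘ι₀)
      (sym (trans (extendʳ (π₁-natural f))
        (trans (∘-resp-≈ʳ π₁∘ι₀) (∘-zeroʳ f)))))

  θ-natural : IsNatural (S ∘F S) S θ
  θ-natural {X} {Y} f = π-jointly-monic
    (begin
      π₀ Y ∘ (θ Y ∘ S₁ (S₁ f))           ≈⟨ π₀∘θ∘ ⟩
      π₀ Y ∘ (π₀ (S₀ Y) ∘ S₁ (S₁ f))     ≈⟨ ππ-natural π₀-natural π₀-natural ⟩
      f ∘ (π₀ X ∘ π₀ (S₀ X))             ≈⟨ ∘-resp-≈ʳ π₀∘θ ⟨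
      f ∘ (π₀ X ∘ θ X)                   ≈⟨ extendʳ (π₀-natural f) ⟨
      π₀ Y ∘ (S₁ f ∘ θ X)                ∎)
    (begin
      π₁ Y ∘ (θ Y ∘ S₁ (S₁ f))           ≈⟨ π₁∘θ∘ (S₁ (S₁ f)) ⟩
      sum (θ-summable (S₁ (S₁ f)))       ≈⟨ sum-cong (ππ-natural π₀-natural π₁-natural)
                                                     (ππ-natural π₁-natural π₀-natural)
                                                     (θ-summable (S₁ (S₁ f))) (summable-∘ˡ f π₀π₁+π₁π₀) ⟩
      sum (summable-∘ˡ f π₀π₁+π₁π₀)      ≈⟨ ∘-distribˡ-sum f π₀π₁+π₁π₀ ⟨
      f ∘ sum π₀π₁+π₁π₀                  ≈⟨ ∘-resp-≈ʳ (π₁-witness (π₀π₀-[π₀π₁+π₁π₀]-summable X)) ⟨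
      f ∘ (π₁ X ∘ θ X)                   ≈⟨ extendʳ (π₁-natural f) ⟨
      π₁ Y ∘ (S₁ f ∘ θ X)                ∎)
    where
      π₀π₁+π₁π₀ = π₀π₁-π₁π₀-summable X

      -- Stated for arbitrary natural `p` and `q` to cover the index pairs 00, 01 and 10 that occur
      -- in `θ`.
      ππ-natural : {p q : ∀ X → S₀ X ⇒ X} → IsNatural S idF p → IsNatural S idF q →
                   p Y ∘ (q (S₀ Y) ∘ S₁ (S₁ f)) ≈ f ∘ (p X ∘ q (S₀ X))
      ππ-natural p-natural q-natural =
        trans (∘-resp-≈ʳ (q-natural (S₁ f))) (extendʳ (p-natural f))

  -- After `π₁`, moving the inner projection past `S₁ (ι₀ X)` turns the two summands into `π₁ X` and
  -- 0; for the other unit law they become 0 and `π₁ X`.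
  θ-identityˡ : ∀ X → θ X ∘ S₁ (ι₀ X) ≈ id
  θ-identityˡ X = π-jointly-monic
    (begin
      π₀ X ∘ (θ X ∘ S₁ (ι₀ X))           ≈⟨ π₀∘θ∘ ⟩
      π₀ X ∘ (π₀ (S₀ X) ∘ S₁ (ι₀ X))     ≈⟨ ∘-resp-≈ʳ (π₀-natural (ι₀ X)) ⟩
      π₀ X ∘ (ι₀ X ∘ π₀ X)               ≈⟨ cancelˡ π₀∘ι₀ ⟩
      π₀ X                               ≈⟨ identityʳ ⟨
      π₀ X ∘ id                          ∎)
    (begin
      π₁ X ∘ (θ X ∘ S₁ (ι₀ X))           ≈⟨ π₁∘θ∘ (S₁ (ι₀ X)) ⟩
      sum (θ-summable (S₁ (ι₀ X)))       ≈⟨ sum-cong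
                                              (trans (∘-resp-≈ʳ (π₁-natural (ι₀ X))) (cancelˡ π₀∘ι₀))
                                              (trans (∘-resp-≈ʳ (π₀-natural (ι₀ X))) (annihilateˡ π₁∘ι₀))
                                              (θ-summable (S₁ (ι₀ X))) (summable-zeroʳ (π₁ X)) ⟩
      sum (summable-zeroʳ (π₁ X))       ≈⟨ sum-identityʳ (summable-zeroʳ (π₁ X)) ⟩
      π₁ X                               ≈⟨ identityʳ ⟨
      π₁ X ∘ id                          ∎)

  θ-identityʳ : ∀ X → θ X ∘ ι₀ (S₀ X) ≈ id
  θ-identityʳ X = π-jointly-monic
    (begin
      π₀ X ∘ (θ X ∘ ι₀ (S₀ X))           ≈⟨ π₀∘θ∘ ⟩
      π₀ X ∘ (π₀ (S₀ X) ∘ ι₀ (S₀ X))     ≈⟨ ∘-resp-≈ʳ π₀∘ι₀ ⟩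
      π₀ X ∘ id                          ∎)
    (begin
      π₁ X ∘ (θ X ∘ ι₀ (S₀ X))           ≈⟨ π₁∘θ∘ (ι₀ (S₀ X)) ⟩
      sum (θ-summable (ι₀ (S₀ X)))       ≈⟨ sum-cong
                                              (trans (∘-resp-≈ʳ π₁∘ι₀) (∘-zeroʳ (π₀ X)))
                                              (∘-resp-≈ʳ π₀∘ι₀)
                                              (θ-summable (ι₀ (S₀ X))) (summable-zeroˡ (π₁ X ∘ id)) ⟩
      sum (summable-zeroˡ (π₁ X ∘ id))  ≈⟨ sum-identityˡ (summable-zeroˡ (π₁ X ∘ id)) ⟩
      π₁ X ∘ id                          ∎)

  θ-assoc : ∀ X → θ X ∘ S₁ (θ X) ≈ θ X ∘ θ (S₀ X)
  θ-assoc X = π-jointly-monic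
    (begin
      π₀ X ∘ (θ X ∘ S₁ (θ X))                   ≈⟨ π₀∘θ∘ ⟩
      π₀ X ∘ (π₀ (S₀ X) ∘ S₁ (θ X))             ≈⟨ ∘-resp-≈ʳ (π₀-natural (θ X)) ⟩
      π₀ X ∘ (θ X ∘ π₀ (S₀ (S₀ X)))             ≈⟨ π₀∘θ∘ ⟩
      π₀ X ∘ (π₀ (S₀ X) ∘ π₀ (S₀ (S₀ X)))       ≈⟨ ∘-resp-≈ʳ π₀∘θ ⟨
      π₀ X ∘ (π₀ (S₀ X) ∘ θ (S₀ X))             ≈⟨ π₀∘θ∘ ⟨
      π₀ X ∘ (θ X ∘ θ (S₀ X))                   ∎)
    (begin
      π₁ X ∘ (θ X ∘ S₁ (θ X))                   ≈⟨ π₁∘θ∘ (S₁ (θ X)) ⟩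
      sum (θ-summable (S₁ (θ X)))               ≈⟨ sum-cong π₀π₁Sθ π₁π₀Sθ (θ-summable (S₁ (θ X))) x,yz ⟩
      sum x,yz                                  ≈⟨ sum-assoc xy xy,z yz x,yz ⟨
      sum xy,z                                  ≈⟨ sum-cong π₀π₁θ π₁π₀θ (θ-summable (θ (S₀ X))) xy,z ⟨
      sum (θ-summable (θ (S₀ X)))               ≈⟨ π₁∘θ∘ (θ (S₀ X)) ⟨
      π₁ X ∘ (θ X ∘ θ (S₀ X))                   ∎)
    where
      S²X = S₀ (S₀ X)

      -- The three threefold projections containing `π₁` exactly once. Both sides of the law have
      -- their sum as second component, bracketed differently.
      x y z : S₀ S²X ⇒ X
      x = π₀ X ∘ (π₀ (S₀ X) ∘ π₁ S²X)
      y = π₀ X ∘ (π₁ (S₀ X) ∘ π₀ S²X)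
      z = π₁ X ∘ (π₀ (S₀ X) ∘ π₀ S²X)

      yz : Summable y z
      yz = θ-summable (π₀ S²X)

      xy : Summable x y
      xy = summable-∘ˡ (π₀ X) (π₀π₁-π₁π₀-summable (S₀ X))

      π₀π₁Sθ : π₀ X ∘ (π₁ (S₀ X) ∘ S₁ (θ X)) ≈ x
      π₀π₁Sθ = trans (∘-resp-≈ʳ (π₁-natural (θ X))) π₀∘θ∘

      π₁π₀Sθ : π₁ X ∘ (π₀ (S₀ X) ∘ S₁ (θ X)) ≈ sum yz
      π₁π₀Sθ = trans (∘-resp-≈ʳ (π₀-natural (θ X))) (π₁∘θ∘ (π₀ S²X))

      π₀π₁θ : π₀ X ∘ (π₁ (S₀ X) ∘ θ (S₀ X)) ≈ sum xy
      π₀π₁θ = trans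
        (∘-resp-≈ʳ (π₁-witness (π₀π₀-[π₀π₁+π₁π₀]-summable (S₀ X))))
        (∘-distribˡ-sum (π₀ X) (π₀π₁-π₁π₀-summable (S₀ X)))

      π₁π₀θ : π₁ X ∘ (π₀ (S₀ X) ∘ θ (S₀ X)) ≈ z
      π₁π₀θ = ∘-resp-≈ʳ π₀∘θ

      -- The summabilities of both bracketings are read off from the two composites with `θ X`, by
      -- rewriting their summands.
      x,yz : Summable x (sum yz)
      x,yz = summable-resp-≈ π₀π₁Sθ π₁π₀Sθ (θ-summable (S₁ (θ X)))

      xy,z : Summable (sum xy) z
      xy,z = summable-resp-≈ π₀π₁θ π₁π₀θ (θ-summable (θ (S₀ X)))

mainTheorem2 : ∀ {o ℓ e : Level} (𝓛 : SummableCategory o ℓ e) →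
    let open SummableCategory 𝓛 in
    IsMonad S ι₀ θ
mainTheorem2 𝓛 = record
  { η-natural   = ι₀-natural
  ; μ-natural   = θ-natural
  ; μ-assoc     = θ-assoc
  ; μ-identityˡ = θ-identityˡ
  ; μ-identityʳ = θ-identityʳ
  }
  where open SumProperties 𝓛
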